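{- Consider triples $(U,\mathcal{O},X)$, where $U$ is a finite set, $\mathcal{O}\subseteq\mathcal{P}(U)$ is a set of obligations (not assumed independent), and $X\subseteq U$ is nonempty and $\preceq_s$-closed. Then: (1) $X$ does not necessarily contain all best elements, i.e. there is such a triple for which some best element of $U$ is not in $X$. Assume in addition that $X$ contains all best elements of $U$. Then: (2) $X\prec_{l,s}U\setminus X$ does not necessarily hold (there is such a triple for which it fails). (3) $X$ is (ui). (4) $X\in\mathcal{D}(\mathcal{O})$ does not necessarily hold (there is such a triple for which it fails). (5) $X$ is not necessarily a neighbourhood of the set of best elements in $U$ (there is such a triple for which it is not). (6) $X$ is an improving neighbourhood of the set of best elements in $U$.
   Context: $U$ is a finite set (the set of situations under consideration), and $\mathcal{O}\subseteq\mathcal{P}(U)$ is a set of "obligations". For $x,y\in U$: - $\mathcal{O}(x):=\{O\in\mathcal{O}: x\in O\}$. - Quality (set variant; smaller means better): $x\sim_s y$ iff $\mathcal{O}(x)=\mathcal{O}(y)$; $x\preceq_s y$ iff $\mathcal{O}(y)\subseteq\mathcal{O}(x)$; $x\prec_s y$ iff $\mathcal{O}(y)\subsetneq\mathcal{O}(x)$. - Distance (set variant): $d_s(x,y):=\mathcal{O}(x)\,\triangle\,\mathcal{O}(y)$ (symmetric difference); distances are compared by inclusion, so they form a partial order. - $[x,z]_s:=\{y\in U: d_s(x,z)=d_s(x,y)\cup d_s(y,z)\}$. - A best element of $U$ is some $x\in U$ such that there is no $z\in U$ with $z\prec_s x$. - $X\subseteq U$ is $\preceq_s$-closed iff for all $x\in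 X$, $y\in U$: $y\preceq_s x$ implies $y\in X$. - An element $x'$ of a set $Y$ is closest to $x$ in $Y$ iff there is no $x''\in Y$ with $d_s(x,x'')\subsetneq d_s(x,x')$. Let $x\parallel Y$ be the set of elements of $Y$ closest to $x$. - $X\prec_{l,s}Y$ iff for all $x\in X$ and all $y\in x\parallel Y$ we have $x\prec_s y$, and for all $y\in Y$ and all $x\in y\parallel X$ we have $x\prec_s y$. - $X$ is (ui) (union of intersections) iff there is a family $(\mathcal{O}_i)_{i\in I}$ with $\mathcal{O}_i\subseteq\mathcal{O}$ and $X=\bigcup_{i\in I}\bigcap\mathcal{O}_i$, where $\bigcap\emptyset:=U$. - For $\mathcal{O}'\subseteq\mathcal{O}$, $\delta:\mathcal{O}'\to\{0,1\}$ and $m\in U$, $m\models\delta$ iff for all $O\in\mathcal{O}'$: $m\in O\Leftrightarrow\delta(O)=1$. - $X\in\mathcal{D}(\mathcal{O})$ iff for all $\mathcal{O}'\subseteq\mathcal{O}$, all $\delta:\mathcal{O}'\to\{0,1\}$ and all $m,m'\in U$ with $m,m'\models\delta$, $m\in X$, $m'\notin X$, there is $m''\in X$ with $m''\models\delta$ and $m''\prec_s m'$. - For $B\subseteq Y\subseteq U$: $Y$ is a neighbourhood of $B$ in $U$ iff for all $y\in Y$ and all $x\in B$ closest to $y$ in $B$, $[x,y]_s\subseteq Y$. $Y$ is an improving neighbourhood of $B$ in $U$ iff for all $y\in Y$ and all $x$ that are closest to $y$ in $\{x'\in B: x'\preceq_s y\}$, $[x,y]_s\subseteq Y$. (Both notions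 require $B\subseteq Y$.) -}

module Defs where

open import Data.Bool using (Bool; true)
open import Data.Fin using (Fin)
open import Data.Fin.Subset using (Subset; _∈_; _∉_; Nonempty)
open import Data.Nat using (ℕ)
open import Data.Product using (Σ-syntax; ∃-syntax; _×_)
open import Function.Bundles using (_⇔_)
open import Level using (0ℓ)
open import Relation.Binary.PropositionalEquality using (_≡_)
open import Relation.Nullary using (¬_)
open import Relation.Unary using (Pred; _⊆_; _⊂_; _≐_; _∪_; _∖_; ⋃)

-- U is Fin n and 𝒫(U) is Subset n.  Sets of subsets of U, and the sets of
-- elements of U that are carved out by a property, are predicates.

⋂ₛ : ∀ {n} → Pred (Subset n) 0ℓ → Pred (Fin n) 0ℓ
⋂ₛ 𝒪′ x = ∀ O → 𝒪′ O → x ∈ O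

module Obligations {n : ℕ} (𝒪 : Pred (Subset n) 0ℓ) where

  infix 4 _⪯_ _≺_ _≺ₗ_
  infix 5 _∥_

  𝒪⟨_⟩ : Fin n → Pred (Subset n) 0ℓ
  𝒪⟨ x ⟩ O = 𝒪 O × x ∈ O

  _⪯_ : Fin n → Fin n → Set
  x ⪯ y = 𝒪⟨ y ⟩ ⊆ 𝒪⟨ x ⟩

  _≺_ : Fin n → Fin n → Set
  x ≺ y = 𝒪⟨ y ⟩ ⊂ 𝒪⟨ x ⟩

  d : Fin n → Fin n → Pred (Subset n) 0ℓ
  d x y = (𝒪⟨ x ⟩ ∖ 𝒪⟨ y ⟩) ∪ (𝒪⟨ y ⟩ ∖ 𝒪⟨ x ⟩)

  [_,_] : Fin n → Fin n → Pred (Fin n) 0ℓ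
  [ x , z ] y = d x z ≐ d x y ∪ d y z

  Best : Pred (Fin n) 0ℓ
  Best x = ¬ (∃[ z ] z ≺ x)

  Closed : Subset n → Set
  Closed X = ∀ x y → x ∈ X → y ⪯ x → y ∈ X

  _∥_ : Fin n → Pred (Fin n) 0ℓ → Pred (Fin n) 0ℓ
  (x ∥ Y) x′ = Y x′ × ¬ (∃[ x″ ] (Y x″ × d x x″ ⊂ d x x′))

  _≺ₗ_ : Subset n → Subset n → Set
  X ≺ₗ Y = (∀ x y → x ∈ X → (x ∥ (_∈ Y)) y → x ≺ y)
         × (∀ x y → y ∈ Y → (y ∥ (_∈ X)) x → x ≺ y)

  UI : Subset n → Set₁
  UI X = Σ[ I ∈ Set ] Σ[ 𝒪ᵢ ∈ (I → Pred (Subset n) 0ℓ) ]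
           (∀ i → 𝒪ᵢ i ⊆ 𝒪) × ((_∈ X) ≐ ⋃ I (λ i → ⋂ₛ (𝒪ᵢ i)))

  -- The irrelevant argument makes δ a function of the obligation alone, not
  -- of the proof that the obligation belongs to 𝒪′.
  Assignment : Pred (Subset n) 0ℓ → Set
  Assignment 𝒪′ = ∀ O → .(𝒪′ O) → Bool

  Satisfies : (𝒪′ : Pred (Subset n) 0ℓ) → Assignment 𝒪′ → Pred (Fin n) 0ℓ
  Satisfies 𝒪′ δ m = ∀ O (O∈𝒪′ : 𝒪′ O) → m ∈ O ⇔ δ O O∈𝒪′ ≡ true

  𝒟 : Subset n → Set₁
  𝒟 X = ∀ (𝒪′ : Pred (Subset n) 0ℓ) → 𝒪′ ⊆ 𝒪 → (δ : Assignment 𝒪′) →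
        ∀ m m′ → Satisfies 𝒪′ δ m → Satisfies 𝒪′ δ m′ → m ∈ X → m′ ∉ X →
        ∃[ m″ ] (m″ ∈ X × Satisfies 𝒪′ δ m″ × m″ ≺ m′)

  Neighbourhood : Subset n → Pred (Fin n) 0ℓ → Set
  Neighbourhood Y B =
    B ⊆ (_∈ Y) ×
    (∀ y x → y ∈ Y → (y ∥ B) x → [ x , y ] ⊆ (_∈ Y))

  ImprovingNeighbourhood : Subset n → Pred (Fin n) 0ℓ → Set
  ImprovingNeighbourhood Y B =
    B ⊆ (_∈ Y) ×
    (∀ y x → y ∈ Y → (y ∥ (λ x′ → B x′ × x′ ⪯ y)) x → [ x , y ] ⊆ (_∈ Y))

record Triple : Set₁ where
  field
    n        : ℕ
    𝒪        : Pred (Subset n) 0ℓ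
    X        : Subset n
  open Obligations 𝒪 public
  field
    nonempty : Nonempty X
    closed   : Closed X

  ContainsBest : Set
  ContainsBest = Best ⊆ (_∈ X)

{-# OPTIONS --safe #-}
module Submission where

-- If X is closed, it is the union over x ∈ X of the sets ⋂ 𝒪⟨ x ⟩ of elements at
-- least as good as x.  Every z ∈ [ x , y ] meets the obligations common to x and
-- y, so x ⪯ y forces z ⪯ y, and closedness keeps z in X.  In the counterexamples
-- 𝒪 is listed explicitly, so every notion but 𝒟 is decided by computation.

open import Defs
open import Data.Fin.Subset using (_∉_; ∁)
open import Data.Product using (∃-syntax; _×_)
open import Relation.Nullary using (¬_)

open import Data.Bool using (false)
import Data.Bool.Properties as Bool
open import Data.Empty using (⊥-elim)
open import Data.Fin using (Fin)
open import Data.Fin.Patterns using (0F; 1F; 2F)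
open import Data.Fin.Properties using (all?; any?)
open import Data.Fin.Subset using (Subset; _∈_; inside; outside)
open import Data.Fin.Subset.Properties using (_∈?_; nonempty?)
open import Data.List using (List; []; _∷_)
import Data.List.Membership.DecPropositional as DecMembership
open import Data.List.Membership.Propositional using () renaming (_∈_ to _∈ₗ_)
open import Data.List.Relation.Unary.All as All using ()
open import Data.List.Relation.Unary.Any using (here; there)
open import Data.Nat using (ℕ)
open import Data.Product using (Σ; _,_; proj₁; proj₂)
open import Data.Sum using (inj₁; inj₂)
open import Data.Vec using ([]; _∷_)
open import Data.Vec.Properties using (≡-dec)
open import Function using (case_of_)
open import Function.Bundles using (Equivalence; mk⇔)
open import Level using (0ℓ)
open import Relation.Binary.PropositionalEquality using (refl; _≡_)
open import Relation.Nullary using (Dec; yes; no)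
open import Relation.Nullary.Decidable
  using (map′; _×-dec_; _⊎-dec_; _→-dec_; ¬?; from-yes; from-no)
open import Relation.Unary using (Pred; Decidable; _⊆_; _⊂_; _∪_)

module _ {n : ℕ} {𝒪 : Pred (Subset n) 0ℓ} where

  open Obligations 𝒪

  closed⇒UI : ∀ {X} → Closed X → UI X
  closed⇒UI {X} closed =
      Σ (Fin n) (_∈ X)
    , (λ (x , _) → 𝒪⟨ x ⟩)
    , (λ _ → proj₁)
    , (λ {x} x∈X → (x , x∈X) , λ _ → proj₂)
    , (λ {y} ((x , x∈X) , y∈⋂) →
         closed x y x∈X λ {O} O∈ → proj₁ O∈ , y∈⋂ O O∈)

  between⇒⪯ : ∀ {x y z} → x ⪯ y → [ x , y ] z → z ⪯ y
  between⇒⪯ {z = z} x⪯y (_ , d⊇) {O} O∈y@(O∈𝒪 , _) with z ∈? O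
  ... | yes z∈O = O∈𝒪 , z∈O
  -- Since `x` meets `O` and `z` does not, `O` lies in `d x z`, hence in `d x y`, although both `x`
  -- and `y` meet it.
  ... | no  z∉O with d⊇ (inj₁ (inj₁ (x⪯y O∈y , λ (_ , z∈O) → z∉O z∈O)))
  ...   | inj₁ (_ , O∉y) = ⊥-elim (O∉y O∈y)
  ...   | inj₂ (_ , O∉x) = ⊥-elim (O∉x (x⪯y O∈y))

  -- Stated for an arbitrary `B` inside `X`; the intended instance is the set of best elements.
  closed⇒improvingNeighbourhood :
    ∀ {X B} → Closed X → B ⊆ (_∈ X) → ImprovingNeighbourhood X B
  closed⇒improvingNeighbourhood closed B⊆X =
      B⊆X
    , λ y x y∈X ((_ , x⪯y) , _) {z} z∈[x,y] →
        closed y z y∈X (between⇒⪯ x⪯y z∈[x,y])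

module DecidableObligations {n : ℕ} (𝒪s : List (Subset n)) where

  open Obligations (_∈ₗ 𝒪s)
  open DecMembership {A = Subset n} (≡-dec Bool._≟_) using () renaming (_∈?_ to _∈ₗ?_)

  -- Inclusion ranges over all subsets of `Fin n`, but every member of `P` is listed, so testing the
  -- entries of `𝒪s` settles it.
  ⊆-listed? : {P Q : Pred (Subset n) 0ℓ} → P ⊆ (_∈ₗ 𝒪s) →
              Decidable P → Decidable Q → Dec (P ⊆ Q)
  ⊆-listed? P⊆𝒪 P? Q? =
    map′ (λ all PO → All.lookup all (P⊆𝒪 PO) PO)
         (λ P⊆Q → All.tabulate λ _ → P⊆Q)
         (All.all? (λ O → P? O →-dec Q? O) 𝒪s)

  ⊂-listed? : {P Q : Pred (Subset n) 0ℓ} →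
              P ⊆ (_∈ₗ 𝒪s) → Q ⊆ (_∈ₗ 𝒪s) →
              Decidable P → Decidable Q → Dec (P ⊂ Q)
  ⊂-listed? P⊆𝒪 Q⊆𝒪 P? Q? =
    ⊆-listed? P⊆𝒪 P? Q? ×-dec ¬? (⊆-listed? Q⊆𝒪 Q? P?)

  𝒪⟨_⟩? : ∀ x → Decidable 𝒪⟨ x ⟩
  𝒪⟨ x ⟩? O = (O ∈ₗ? 𝒪s) ×-dec (x ∈? O)

  d? : ∀ x y → Decidable (d x y)
  d? x y O = (𝒪⟨ x ⟩? O ×-dec ¬? (𝒪⟨ y ⟩? O))
         ⊎-dec (𝒪⟨ y ⟩? O ×-dec ¬? (𝒪⟨ x ⟩? O))

  d⊆𝒪 : ∀ x y → d x y ⊆ (_∈ₗ 𝒪s)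
  d⊆𝒪 x y (inj₁ ((O∈𝒪 , _) , _)) = O∈𝒪
  d⊆𝒪 x y (inj₂ ((O∈𝒪 , _) , _)) = O∈𝒪

  _⪯?_ : ∀ x y → Dec (x ⪯ y)
  x ⪯? y = ⊆-listed? proj₁ 𝒪⟨ y ⟩? 𝒪⟨ x ⟩?

  _≺?_ : ∀ x y → Dec (x ≺ y)
  x ≺? y = ⊂-listed? proj₁ proj₁ 𝒪⟨ y ⟩? 𝒪⟨ x ⟩?

  [_,_]? : ∀ x z → Decidable [ x , z ]
  [ x , z ]? y =
          ⊆-listed? (d⊆𝒪 x z) (d? x z) xy∪yz?
    ×-dec ⊆-listed? (λ { (inj₁ p) → d⊆𝒪 x y p ; (inj₂ p) → d⊆𝒪 y z p })
                    xy∪yz? (d? x z)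
    where
    xy∪yz? : Decidable (d x y ∪ d y z)
    xy∪yz? O = d? x y O ⊎-dec d? y z O

  Best? : Decidable Best
  Best? x = ¬? (any? (_≺? x))

  Closed? : Decidable Closed
  Closed? X = all? λ x → all? λ y → (x ∈? X) →-dec (y ⪯? x) →-dec (y ∈? X)

  ⊆-Fin? : {P Q : Pred (Fin n) 0ℓ} → Decidable P → Decidable Q → Dec (P ⊆ Q)
  ⊆-Fin? P? Q? = map′ (λ f {x} → f x) (λ f x → f {x})
                      (all? λ x → P? x →-dec Q? x)

  closest? : ∀ x {Y} → Decidable Y → Decidable (x ∥ Y)
  closest? x Y? x′ = Y? x′ ×-dec ¬? (any? λ x″ → Y? x″ ×-dec
    ⊂-listed? (d⊆𝒪 x x″) (d⊆𝒪 x x′) (d? x x″) (d? x x′))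

  _≺ₗ?_ : ∀ X Y → Dec (X ≺ₗ Y)
  X ≺ₗ? Y =
          (all? λ x → all? λ y →
             (x ∈? X) →-dec closest? x (_∈? Y) y →-dec (x ≺? y))
    ×-dec (all? λ x → all? λ y →
             (y ∈? Y) →-dec closest? y (_∈? X) x →-dec (x ≺? y))

  Neighbourhood? : ∀ X {B} → Decidable B → Dec (Neighbourhood X B)
  Neighbourhood? X B? =
          ⊆-Fin? B? (_∈? X)
    ×-dec (all? λ y → all? λ x → (y ∈? X) →-dec closest? y B? x →-dec
             ⊆-Fin? [ x , y ]? (_∈? X))

-- 𝒪⟨0⟩ = {a} and 𝒪⟨1⟩ = {b}, so both elements are best.
module TwoBest where

  a b X : Subset 2
  a = inside ∷ outside ∷ []
  b = outside ∷ inside ∷ []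
  X = a

  open DecidableObligations (a ∷ b ∷ [])

  triple : Triple
  triple = record
    { 𝒪 = _∈ₗ (a ∷ b ∷ []) ; X = X
    ; nonempty = from-yes (nonempty? X) ; closed = from-yes (Closed? X) }

  open Triple triple using (Best)

  best∉X : ∃[ x ] (Best x × x ∉ X)
  best∉X = 1F , from-yes (Best? 1F) , from-no (1F ∈? X)

-- 𝒪⟨0⟩ = {a}, 𝒪⟨1⟩ = {b} and 𝒪⟨2⟩ = {a, b, c}: the elements 0 ∈ X and 1 ∉ X are
-- incomparable, and among the elements violating c nothing improves on 1.
module IncomparableOutside where

  a b c X : Subset 3
  a = inside ∷ outside ∷ inside ∷ []
  b = outside ∷ inside ∷ inside ∷ []
  c = outside ∷ outside ∷ inside ∷ []
  X = a

  open DecidableObligations (a ∷ b ∷ c ∷ [])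

  triple : Triple
  triple = record
    { 𝒪 = _∈ₗ (a ∷ b ∷ c ∷ []) ; X = X
    ; nonempty = from-yes (nonempty? X) ; closed = from-yes (Closed? X) }

  open Triple triple using (ContainsBest; _≺ₗ_; 𝒟; Satisfies)

  -- Meeting all three obligations, 2 is better than 0 and 1, so it is the only best element.
  containsBest : ContainsBest
  containsBest = from-yes (⊆-Fin? Best? (_∈? X))

  -- The complement of `X` contains only 1, so 1 is closest to 0 there, yet 0 is not better than 1.
  X⊀ₗ∁X : ¬ (X ≺ₗ ∁ X)
  X⊀ₗ∁X = from-no (X ≺ₗ? ∁ X)

  -- Fixing the single obligation `c` to 0 excludes 2, the only element better than 1.
  violates-c : ∀ {m} → m ∉ c → Satisfies (_≡ c) (λ _ _ → false) m
  violates-c m∉c _ refl = mk⇔ (λ m∈c → ⊥-elim (m∉c m∈c)) (λ ())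

  ¬𝒟X : ¬ 𝒟 X
  ¬𝒟X X∈𝒟 with X∈𝒟 (_≡ c) (λ { refl → there (there (here refl)) })
                   (λ _ _ → false) 0F 1F
                   (violates-c (from-no (0F ∈? c))) (violates-c (from-no (1F ∈? c)))
                   (from-yes (0F ∈? X)) (from-no (1F ∈? X))
  ... | m , m∈X , m⊨δ , m≺1 =
    -- `𝒟` quantifies over predicates, but the witness it yields ranges over a finite set: in `X`
    -- and outside `c` there is only 0, which does not improve on 1.
    from-no (any? λ m → (m ∈? X) ×-dec ¬? (m ∈? c) ×-dec (m ≺? 1F))
      (m , m∈X , (λ m∈c → case Equivalence.to (m⊨δ c refl) m∈c of λ ()) , m≺1)

-- 𝒪⟨0⟩ = {a}, 𝒪⟨1⟩ = {b}, 𝒪⟨2⟩ = {a, c} and 𝒪⟨3⟩ = ∅: the best element 1 is among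
-- the closest to 0, since d 0 1 = {a, b} does not contain d 0 2 = {c}; but 3 ∉ X
-- lies between 0 and 1.
module WorseBetween where

  a b c X : Subset 4
  a = inside ∷ outside ∷ inside ∷ outside ∷ []
  b = outside ∷ inside ∷ outside ∷ outside ∷ []
  c = outside ∷ outside ∷ inside ∷ outside ∷ []
  -- Only 3 is left out: meeting no obligation, it is not at least as good as any element of `X`.
  X = inside ∷ inside ∷ inside ∷ outside ∷ []

  open DecidableObligations (a ∷ b ∷ c ∷ [])

  triple : Triple
  triple = record
    { 𝒪 = _∈ₗ (a ∷ b ∷ c ∷ []) ; X = X
    ; nonempty = from-yes (nonempty? X) ; closed = from-yes (Closed? X) }

  open Triple triple using (Best; ContainsBest; Neighbourhood)

  containsBest : ContainsBest
  containsBest = from-yes (⊆-Fin? Best? (_∈? X))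

  -- Betweenness of 3 holds because `d 1 3` = {b} and `d 3 0` = {a} together make up `d 1 0` = {a,
  -- b}.
  ¬neighbourhood : ¬ Neighbourhood X Best
  ¬neighbourhood = from-no (Neighbourhood? X Best?)

fact4p1 : (∃[ T ] (let open Triple T in ∃[ x ] (Best x × x ∉ X)))
    × (∃[ T ] (let open Triple T in ContainsBest × ¬ (X ≺ₗ ∁ X)))
    × ((T : Triple) → let open Triple T in ContainsBest → UI X)
    × (∃[ T ] (let open Triple T in ContainsBest × ¬ 𝒟 X))
    × (∃[ T ] (let open Triple T in ContainsBest × ¬ Neighbourhood X Best))
    × ((T : Triple) → let open Triple T in ContainsBest → ImprovingNeighbourhood X Best)
fact4p1 =
    (TwoBest.triple , TwoBest.best∉X)
  , (IncomparableOutside.triple ,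
     IncomparableOutside.containsBest , IncomparableOutside.X⊀ₗ∁X)
  , (λ T _ → closed⇒UI (Triple.closed T))
  , (IncomparableOutside.triple ,
     IncomparableOutside.containsBest , IncomparableOutside.¬𝒟X)
  , (WorseBetween.triple ,
     WorseBetween.containsBest , WorseBetween.¬neighbourhood)
  , (λ T → closed⇒improvingNeighbourhood (Triple.closed T))
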